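{- Let $G$ be an isolate-free graph with maximum degree $\Delta(G)$ even and $\Delta(G)\ge 6$, such that $TC(G)=\frac{\Delta(G)^2}{4}+\Delta(G)+1$. Then the total coalition graph of a total coalition partition of $G$ of maximum cardinality is determined up to isomorphism and does not depend on the realising total coalition partition; that is, for any two total coalition partitions $\Psi,\Psi'$ of $G$ with $TC(G)$ classes each, the graphs $TCG(G,\Psi)$ and $TCG(G,\Psi')$ are isomorphic.
   Context: All graphs are finite and simple (no loops or multiple edges). A graph is isolate-free if it has no vertex of degree $0$. A set $T\subseteq V$ of vertices of a graph $G(V,E)$ is a total dominating set if every vertex of $V$ is adjacent to at least one vertex of $T$. Two disjoint sets $A,B\subset V$ form a total coalition if neither $A$ nor $B$ is a total dominating set, but $A\cup B$ is. A total coalition partition of $G$ is a partition $\Psi=\{C_1,\dots,C_k\}$ of $V$ into non-empty classes such that for every $i$ there exists $j\neq i$ such that $C_i$ and $C_j$ form a total coalition. The total coalition number $TC(G)$ of an isolate-free graph $G$ is the maximum cardinality (number of classes) of a total coalition partition of $G$. For a total coalition partition $\Psi$ of $G$, the total coalition graph $TCG(G,\Psi)$ has the classes of $\Psi$ as vertices, two classes being adjacent if and only if they form a total coalition. -}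

module Defs where

open import Level using (0ℓ)
open import Data.Nat.Base using (ℕ; _≤_; _⊔_)
open import Data.Fin.Base using (Fin)
open import Data.Fin.Properties using (any?; all?)
open import Data.Fin.Subset using (Subset; _∈_; _∪_; _∩_; ∣_∣; Nonempty; Empty)
open import Data.Fin.Subset.Properties using (_∈?_; nonempty?; ∪-comm; ∩-comm; ∪-idem)
open import Data.List.Base using (allFin; foldr; map)
open import Data.Product.Base using (Σ-syntax; ∃-syntax; _×_; _,_)
open import Data.Vec.Base using (tabulate)
open import Function.Bundles using (_↔_; _⇔_; Inverse)
open import Relation.Binary.Core using (Rel)
open import Relation.Binary.Definitions using (Decidable; Symmetric; Irreflexive)
open import Relation.Binary.PropositionalEquality
  using (_≡_; _≢_; refl; subst)
open import Relation.Nullary.Negation.Core using (¬_)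
open import Relation.Nullary.Decidable using (Dec; does; _×-dec_; ¬?)

-- Adjacency is required to be decidable: a finite graph is a finite table.
record Graph (n : ℕ) : Set₁ where
  infix 4 _~_ _~?_
  field
    _~_     : Rel (Fin n) 0ℓ
    _~?_    : Decidable _~_
    ~-sym   : Symmetric _~_
    ~-irrefl : Irreflexive _≡_ _~_

module _ {n : ℕ} (G : Graph n) where
  open Graph G

  neighbourhood : Fin n → Subset n
  neighbourhood v = tabulate (λ u → does (v ~? u))

  degree : Fin n → ℕ
  degree v = ∣ neighbourhood v ∣

  -- Equal to 0 on the graph without vertices.
  maxDegree : ℕ
  maxDegree = foldr _⊔_ 0 (map degree (allFin n))

  IsolateFree : Set
  IsolateFree = ∀ v → degree v ≢ 0

  TotalDominating : Subset n → Set
  TotalDominating T = ∀ v → ∃[ u ] (u ∈ T × v ~ u)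

  totalDominating? : ∀ T → Dec (TotalDominating T)
  totalDominating? T = all? (λ v → any? (λ u → (u ∈? T) ×-dec (v ~? u)))

infix 4 _≅_

_≅_ : ∀ {m n} → Graph m → Graph n → Set
_≅_ {m} {n} G H =
  Σ[ f ∈ Fin m ↔ Fin n ] (∀ u v → (u G.~ v) ⇔ (Inverse.to f u H.~ Inverse.to f v))
  where
  module G = Graph G
  module H = Graph H

Disjoint : ∀ {n} → Subset n → Subset n → Set
Disjoint A B = Empty (A ∩ B)

module _ {n : ℕ} (G : Graph n) where

  TotalCoalition : Rel (Subset n) 0ℓ
  TotalCoalition A B =
    Disjoint A B × ¬ TotalDominating G A × ¬ TotalDominating G B × TotalDominating G (A ∪ B)

  totalCoalition? : Decidable TotalCoalition
  totalCoalition? A B =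
    ¬? (nonempty? (A ∩ B)) ×-dec ¬? (totalDominating? G A)
      ×-dec ¬? (totalDominating? G B) ×-dec totalDominating? G (A ∪ B)

  totalCoalition-sym : Symmetric TotalCoalition
  totalCoalition-sym {A} {B} (d , ¬a , ¬b , ab) =
    subst Empty (∩-comm A B) d , ¬b , ¬a , subst (TotalDominating G) (∪-comm A B) ab

  totalCoalition-irrefl : Irreflexive _≡_ TotalCoalition
  totalCoalition-irrefl {A} refl (_ , ¬a , _ , aa) =
    ¬a (subst (TotalDominating G) (∪-idem A) aa)

-- A partition into k classes, enumerated by Fin k. Nonemptiness and
-- disjointness make the enumeration injective, so k is its cardinality.
record Partition (n k : ℕ) : Set where
  field
    class    : Fin k → Subset n
    nonempty : ∀ i → Nonempty (class i)
    disjoint : ∀ i j → i ≢ j → Disjoint (class i) (class j)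
    covering : ∀ v → ∃[ i ] v ∈ class i

record TotalCoalitionPartition {n : ℕ} (G : Graph n) (k : ℕ) : Set where
  field
    partition : Partition n k
  open Partition partition public
  field
    partner : ∀ i → ∃[ j ] (j ≢ i × TotalCoalition G (class i) (class j))

-- "TC(G) = k".
record IsTotalCoalitionNumber {n : ℕ} (G : Graph n) (k : ℕ) : Set where
  field
    attained : TotalCoalitionPartition G k
    maximal  : ∀ m → TotalCoalitionPartition G m → m ≤ k

TCG : ∀ {n k} (G : Graph n) → TotalCoalitionPartition G k → Graph k
TCG G Ψ = record
  { _~_      = λ i j → TotalCoalition G (class i) (class j)
  ; _~?_     = λ i j → totalCoalition? G (class i) (class j)
  ; ~-sym    = totalCoalition-sym G
  ; ~-irrefl = λ { refl → totalCoalition-irrefl G refl }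
  }
  where open TotalCoalitionPartition Ψ

{-# OPTIONS --safe #-}
-- Call a set of classes a cover if it contains an end of every edge of the
-- coalition graph. For a vertex v of G the set S v of classes meeting the
-- neighbourhood of v has at most Δ elements, and two distinct classes form a
-- coalition exactly when every S v contains one of them; so every S v is a cover.
--
-- Let C be a cover of minimum size s ≤ Δ, and for J ⊆ C let P J be the set of
-- classes outside C all of whose neighbours lie in J. If S = S v, then
-- J ∪ (S ∖ (J ∪ P J)) is again a cover, hence s + |S ∩ J| + |S ∩ P J| ≤ |J| + Δ,
-- while P J ∖ S ⊆ P (S ∩ J). Choosing v such that S v misses an element of J and
-- iterating, |P J| ≤ |J| (Δ − s + 1), and for J = C the number of classes is at
-- most s (Δ − s + 2) ≤ (t + 1)², where Δ = 2t.
--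
-- If equality holds then s = t + 1, and every S v which misses a class A of C
-- contains all the other classes of C and exactly t classes outside C, among them
-- all neighbours of A outside C. So C is a clique, and counting shows that the
-- classes outside C are leaves, t of them at each element of C.
module Submission where

open import Defs
open import Level using (0ℓ)
open import Data.Nat using (ℕ; zero; suc; _+_; _*_; _∸_; _^_; _/_; _≤_; _<_; _≥_; _⊔_; z≤n; s≤s; s≤s⁻¹; _<?_)
open import Data.Nat.Properties hiding (_≟_)
open import Data.Nat.DivMod using (m*n/n≡m)
open import Data.Nat.Divisibility using (_∣_; divides)
open import Data.Nat.Tactic.RingSolver using (solve-∀)
open import Data.Fin as Fin using (Fin; punchOut; remQuot; combine)
open import Data.Fin.Properties as Finₚ using
  (_≟_; any?; all?; ¬∀⟶∃¬; injective⇒≤; punchOut-injective; remQuot-combine)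
open import Data.Fin.Subset using
  (Subset; inside; outside; _∈_; _∉_; _⊆_; _⊂_; _∩_; _∪_; _-_; ∁; ∣_∣)
open import Data.Fin.Subset.Properties using
  ( _∈?_; nonempty?; anySubset?; p⊆q⇒∣p∣≤∣q∣; p⊂q⇒∣p∣<∣q∣; x∈∁p⇒x∉p; x∉p⇒x∈∁p; ∣∁p∣≡n∸∣p∣; ∣p∣≤n
  ; x∈p∩q⁺; x∈p∩q⁻; x∈p∪q⁺; x∈p∪q⁻; p∩q⊆p; p∩q⊆q; x∈p∧x≢y⇒x∈p-y; x∈p⇒∣p-x∣<∣p∣)
open import Data.List.Base using (List; foldr)
open import Data.List.Membership.Propositional.Properties using (∈-map⁺; ∈-allFin)
import Data.List.Membership.Propositional as List
open import Data.List.Relation.Unary.Any using (here; there)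
open import Data.Product using (∃; ∃-syntax; _×_; _,_; proj₁; proj₂; uncurry)
open import Data.Sum using (_⊎_; inj₁; inj₂; [_,_]′; swap)
open import Data.Vec.Base using ([]; _∷_; here; there; tabulate)
open import Data.Vec.Properties using ([]=⇒lookup; lookup⇒[]=; lookup∘tabulate)
open import Function.Base using (_∘_)
open import Function.Bundles using (_↔_; _⇔_; Inverse; Equivalence; mk↔ₛ′; mk⇔)
open import Function.Definitions using (Injective)
import Function.Construct.Composition as Composition
import Function.Construct.Symmetry as Symmetry
open import Relation.Binary.PropositionalEquality using
  (_≡_; _≢_; refl; sym; trans; cong; subst; subst₂; module ≡-Reasoning)
open import Relation.Nullary using (¬_; Dec; does; yes; no; contradiction)
open import Relation.Nullary.Decidable using (dec-true; _×-dec_; _→-dec_; _⊎-dec_; ¬?)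
open import Relation.Unary using (Pred; Decidable)

private variable
  m n k : ℕ

-- Finite sets

-- A missed `y` could be punched out of the codomain, leaving an injection of `Fin (suc n)` into
-- `Fin n`.
injective⇒hits : {h : Fin n → Fin n} → Injective _≡_ _≡_ h → ∀ y → ∃[ x ] h x ≡ y
injective⇒hits {suc n} {h} h-inj y with any? (λ x → h x ≟ y)
... | yes hit  = hit
... | no  miss = contradiction
  (injective⇒≤ {f = λ x → punchOut (y≢h x)} (λ eq → h-inj (punchOut-injective (y≢h _) (y≢h _) eq)))
  (<-irrefl refl)
  where
  y≢h : ∀ x → y ≢ h x
  y≢h x y≡hx = miss (x , sym y≡hx)

-- A section of `f` is an injective self-map of a finite set, so every `x` is one of its values;
-- hence it inverts `f` on both sides.
hits⇒injective : {f : Fin m → Fin n} → m ≡ n → (∀ y → ∃[ x ] f x ≡ y) → Injective _≡_ _≡_ f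
hits⇒injective {f = f} refl hit fa≡fb =
  trans (sym (section∘f _)) (trans (cong section fa≡fb) (section∘f _))
  where
  section = proj₁ ∘ hit

  section-injective : Injective _≡_ _≡_ section
  section-injective {x} {y} eq =
    trans (sym (proj₂ (hit x))) (trans (cong f eq) (proj₂ (hit y)))

  section∘f : ∀ x → section (f x) ≡ x
  section∘f x with y , refl ← injective⇒hits section-injective x = cong section (proj₂ (hit y))

∣p∣≡∣p∩q∣+∣p∩∁q∣ : (p q : Subset n) → ∣ p ∣ ≡ ∣ p ∩ q ∣ + ∣ p ∩ ∁ q ∣
∣p∣≡∣p∩q∣+∣p∩∁q∣ []            []            = refl
∣p∣≡∣p∩q∣+∣p∩∁q∣ (outside ∷ p) (_       ∷ q) = ∣p∣≡∣p∩q∣+∣p∩∁q∣ p q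
∣p∣≡∣p∩q∣+∣p∩∁q∣ (inside  ∷ p) (inside  ∷ q) = cong suc (∣p∣≡∣p∩q∣+∣p∩∁q∣ p q)
∣p∣≡∣p∩q∣+∣p∩∁q∣ (inside  ∷ p) (outside ∷ q) =
  trans (cong suc (∣p∣≡∣p∩q∣+∣p∩∁q∣ p q)) (sym (+-suc _ _))

∣p∪q∣≤∣p∣+∣q∣ : (p q : Subset n) → ∣ p ∪ q ∣ ≤ ∣ p ∣ + ∣ q ∣
∣p∪q∣≤∣p∣+∣q∣ p q = begin
  ∣ p ∪ q ∣                             ≡⟨ ∣p∣≡∣p∩q∣+∣p∩∁q∣ (p ∪ q) p ⟩
  ∣ (p ∪ q) ∩ p ∣ + ∣ (p ∪ q) ∩ ∁ p ∣   ≤⟨ +-mono-≤ (p⊆q⇒∣p∣≤∣q∣ (p∩q⊆q (p ∪ q) p)) (p⊆q⇒∣p∣≤∣q∣ rest⊆q) ⟩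
  ∣ p ∣ + ∣ q ∣                         ∎
  where
  open ≤-Reasoning
  rest⊆q : (p ∪ q) ∩ ∁ p ⊆ q
  rest⊆q x∈ with x∈p∪q , x∈∁p ← x∈p∩q⁻ (p ∪ q) (∁ p) x∈ with x∈p∪q⁻ p q x∈p∪q
  ... | inj₁ x∈p = contradiction x∈p (x∈∁p⇒x∉p x∈∁p)
  ... | inj₂ x∈q = x∈q

disjoint⇒∣p∣+∣q∣≤∣r∣ : (p q r : Subset n) → p ⊆ r → q ⊆ r → (∀ {x} → x ∈ p → x ∉ q) →
                       ∣ p ∣ + ∣ q ∣ ≤ ∣ r ∣
disjoint⇒∣p∣+∣q∣≤∣r∣ p q r p⊆r q⊆r p∩q=∅ = begin
  ∣ p ∣ + ∣ q ∣              ≤⟨ +-mono-≤ (p⊆q⇒∣p∣≤∣q∣ (λ x∈p → x∈p∩q⁺ (p⊆r x∈p , x∈p)))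
                                  (p⊆q⇒∣p∣≤∣q∣ (λ x∈q → x∈p∩q⁺ (q⊆r x∈q , x∉p⇒x∈∁p (λ x∈p → p∩q=∅ x∈p x∈q)))) ⟩
  ∣ r ∩ p ∣ + ∣ r ∩ ∁ p ∣    ≡⟨ ∣p∣≡∣p∩q∣+∣p∩∁q∣ r p ⟨
  ∣ r ∣                      ∎
  where open ≤-Reasoning

comprehension : {P : Pred (Fin n) 0ℓ} → Decidable P → Subset n
comprehension P? = tabulate (does ∘ P?)

module _ {P : Pred (Fin n) 0ℓ} (P? : Decidable P) where

  ∈-comprehension⁺ : ∀ {x} → P x → x ∈ comprehension P?
  ∈-comprehension⁺ {x} px =
    lookup⇒[]= x _ (trans (lookup∘tabulate (does ∘ P?) x) (dec-true (P? x) px))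

  ∈-comprehension⁻ : ∀ {x} → x ∈ comprehension P? → P x
  ∈-comprehension⁻ {x} x∈ with P? x | trans (sym (lookup∘tabulate (does ∘ P?) x)) ([]=⇒lookup x∈)
  ... | yes px | _ = px

enumerate : (p : Subset n) → ∣ p ∣ ≡ m → Fin m → Fin n
enumerate []            refl ()
enumerate (outside ∷ p) eq i           = Fin.suc (enumerate p eq i)
enumerate (inside  ∷ p) eq Fin.zero    = Fin.zero
enumerate (inside  ∷ p) eq (Fin.suc i) = Fin.suc (enumerate p (suc-injective eq) i)

enumerate-∈ : (p : Subset n) (eq : ∣ p ∣ ≡ m) (i : Fin m) → enumerate p eq i ∈ p
enumerate-∈ []            refl ()
enumerate-∈ (outside ∷ p) eq i           = there (enumerate-∈ p eq i)
enumerate-∈ (inside  ∷ p) eq Fin.zero    = here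
enumerate-∈ (inside  ∷ p) eq (Fin.suc i) = there (enumerate-∈ p (suc-injective eq) i)

enumerate-injective : (p : Subset n) (eq : ∣ p ∣ ≡ m) → Injective _≡_ _≡_ (enumerate p eq)
enumerate-injective [] refl {()}
enumerate-injective (outside ∷ p) eq e = enumerate-injective p eq (Finₚ.suc-injective e)
enumerate-injective (inside ∷ p) eq {Fin.zero}  {Fin.zero}  e = refl
enumerate-injective (inside ∷ p) eq {Fin.suc i} {Fin.suc j} e =
  cong Fin.suc (enumerate-injective p (suc-injective eq) (Finₚ.suc-injective e))

enumerate-hits : (p : Subset n) (eq : ∣ p ∣ ≡ m) → ∀ {x} → x ∈ p → ∃[ i ] enumerate p eq i ≡ x
enumerate-hits (outside ∷ p) eq (there x∈p)
  with i , e ← enumerate-hits p eq x∈p = i , cong Fin.suc e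
enumerate-hits {m = suc m} (inside ∷ p) eq here = Fin.zero , refl
enumerate-hits {m = suc m} (inside ∷ p) eq (there x∈p)
  with i , e ← enumerate-hits p (suc-injective eq) x∈p = Fin.suc i , cong Fin.suc e

image⇒∣p∣≤∣q∣ : (f : Fin m → Fin n) (p : Subset n) (q : Subset m) →
                (∀ {x} → x ∈ p → ∃[ y ] (y ∈ q × f y ≡ x)) → ∣ p ∣ ≤ ∣ q ∣
image⇒∣p∣≤∣q∣ f p q preimage = injective⇒≤ {f = index} index-injective
  where
  pre : ∀ i → ∃[ y ] (y ∈ q × f y ≡ enumerate p refl i)
  pre i = preimage (enumerate-∈ p refl i)

  hit : ∀ i → ∃[ j ] enumerate q refl j ≡ proj₁ (pre i)
  hit i = enumerate-hits q refl (proj₁ (proj₂ (pre i)))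

  index : Fin ∣ p ∣ → Fin ∣ q ∣
  index = proj₁ ∘ hit

  f∘index : ∀ i → f (enumerate q refl (index i)) ≡ enumerate p refl i
  f∘index i = trans (cong f (proj₂ (hit i))) (proj₂ (proj₂ (pre i)))

  index-injective : Injective _≡_ _≡_ index
  index-injective {i} {j} eq = enumerate-injective p refl
    (trans (sym (f∘index i)) (trans (cong (f ∘ enumerate q refl) eq) (f∘index j)))

-- Arithmetic

-- The numbers `x` and `x + e + e` have mean `x + e`, and the square of the mean exceeds their
-- product by exactly `e * e`.
square≤product⇒no-gap : ∀ x e → (x + e) * (x + e) ≤ x * (x + e + e) → e ≡ 0
square≤product⇒no-gap x zero    _  = refl
square≤product⇒no-gap x (suc e) le = contradiction le (<⇒≱ (begin-strict
  x * (x + suc e + suc e)                  <⟨ m<m+n _ {suc e * suc e} (s≤s z≤n) ⟩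
  x * (x + suc e + suc e) + suc e * suc e  ≡⟨ expand x (suc e) ⟩
  (x + suc e) * (x + suc e)                ∎))
  where
  open ≤-Reasoning
  expand : ∀ x e → x * (x + e + e) + e * e ≡ (x + e) * (x + e)
  expand = solve-∀

-- The equality case of the inequality between the arithmetic and the geometric mean. The smaller of
-- `a` and `b` plays the role of `x` above, with `e` its distance from the mean `c`.
square≤product⇒equal : ∀ a b c → a + b ≡ c + c → c * c ≤ a * b → a ≡ c
square≤product⇒equal a b c a+b≡c+c c²≤ab with ≤-total a c
... | inj₁ a≤c
  with e , refl ← m≤n⇒∃[o]m+o≡n a≤c
  with refl ← +-cancelˡ-≡ a b (a + e + e)
         (trans a+b≡c+c (trans (+-assoc a e (a + e)) (cong (a +_) (+-comm e (a + e)))))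
  with refl ← square≤product⇒no-gap a e c²≤ab = sym (+-identityʳ a)
... | inj₂ c≤a
  with e , refl ← m≤n⇒∃[o]m+o≡n c≤a
  with refl ← +-cancelˡ-≡ c (e + b) c (trans (sym (+-assoc c e b)) a+b≡c+c)
  with refl ← square≤product⇒no-gap b e (subst₂ _≤_
         (cong (λ z → z * z) (+-comm e b))
         (trans (*-comm (e + b + e) b) (cong (λ z → b * (z + e)) (+-comm e b))) c²≤ab)
  = +-identityʳ _

-- With `t = j + e` the inequality reduces to `e * t ≤ e * 1`, so a positive `e` would force
-- `t ≤ 1`.
j+tt≤t+jt⇒j≡t : ∀ {j t} → 2 ≤ t → j ≤ t → j + t * t ≤ t + j * t → j ≡ t
j+tt≤t+jt⇒j≡t {j} {t} 2≤t j≤t le with m≤n⇒∃[o]m+o≡n j≤t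
... | zero  , refl = sym (+-identityʳ j)
... | suc e , refl = contradiction 2≤t (<⇒≱ (s≤s (*-cancelˡ-≤ (suc e)
  (+-cancelˡ-≤ (j + j * t) _ _ (subst₂ _≤_ (lhs j (suc e)) (rhs j (suc e)) le)))))
  where
  lhs : ∀ j e → j + (j + e) * (j + e) ≡ j + j * (j + e) + e * (j + e)
  lhs = solve-∀
  rhs : ∀ j e → j + e + j * (j + e) ≡ j + j * (j + e) + e * 1
  rhs = solve-∀

x∈xs⇒x≤foldr⊔ : ∀ {x} {xs : List ℕ} → x List.∈ xs → x ≤ foldr _⊔_ 0 xs
x∈xs⇒x≤foldr⊔ (here refl) = m≤m⊔n _ _
x∈xs⇒x≤foldr⊔ (there x∈)  = ≤-trans (x∈xs⇒x≤foldr⊔ x∈) (m≤n⊔m _ _)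

-- Covers of a graph by families of sets

-- The complete graph on `m` vertices with `n` pendant leaves at each of them. The pair `(a , zero)`
-- is the clique vertex `a`, and `(a , suc i)` is the `i`-th leaf attached to it.
data Corona {m n : ℕ} : Fin m × Fin (suc n) → Fin m × Fin (suc n) → Set where
  clique : ∀ {a b} → a ≢ b → Corona (a , Fin.zero) (b , Fin.zero)
  leafʳ  : ∀ {a j} → Corona (a , Fin.zero) (a , Fin.suc j)
  leafˡ  : ∀ {a i} → Corona (a , Fin.suc i) (a , Fin.zero)

module _ (H : Graph k) where
  open Graph H

  IsCover : Subset k → Set
  IsCover C = ∀ a b → a ~ b → a ∈ C ⊎ b ∈ C

  isCover? : Decidable IsCover
  isCover? C = all? λ a → all? λ b → (a ~? b) →-dec ((a ∈? C) ⊎-dec (b ∈? C))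

  IsMinimumCover : Subset k → Set
  IsMinimumCover C = IsCover C × (∀ C′ → IsCover C′ → ∣ C ∣ ≤ ∣ C′ ∣)

  minimumCover : ∀ {C} → IsCover C → ∃ IsMinimumCover
  minimumCover {C} cover = go ∣ C ∣ C cover ≤-refl
    where
    go : ∀ b C → IsCover C → ∣ C ∣ ≤ b → ∃ IsMinimumCover
    go b C cover ∣C∣≤b with anySubset? (λ C′ → isCover? C′ ×-dec (∣ C′ ∣ <? ∣ C ∣))
    ... | no  none = C , cover , λ C′ cover′ → ≮⇒≥ (λ smaller → none (C′ , cover′ , smaller))
    go zero    C cover ∣C∣≤b | yes (C′ , cover′ , smaller) =
      contradiction (≤-trans smaller ∣C∣≤b) λ ()
    go (suc b) C cover ∣C∣≤b | yes (C′ , cover′ , smaller) =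
      go b C′ cover′ (s≤s⁻¹ (≤-trans smaller ∣C∣≤b))

-- What the counting argument retains of a coalition partition. Together, `covers` and `edge`
-- determine the edges of `H` from the sets `S v`; `misses` expresses that no class is totally
-- dominating on its own.
record CoverFamily (H : Graph k) (n Δ : ℕ) : Set where
  open Graph H
  field
    S       : Fin n → Subset k
    covers  : ∀ v → IsCover H (S v)
    edge    : ∀ {a b} → a ≢ b → (∀ v → a ∈ S v ⊎ b ∈ S v) → a ~ b
    misses  : ∀ a → ∃[ v ] a ∉ S v
    partner : ∀ a → ∃[ b ] a ~ b
    ∣S∣≤Δ   : ∀ v → ∣ S v ∣ ≤ Δ

-- Private neighbours of subsets of a minimum cover

module PrivateNeighbours {H : Graph k} {Δ : ℕ} (F : CoverFamily H n Δ)
                         {C : Subset k} (minimum : IsMinimumCover H C) where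
  open Graph H
  open CoverFamily F

  IsPrivate : Subset k → Pred (Fin k) 0ℓ
  IsPrivate J x = x ∉ C × (∀ y → x ~ y → y ∈ J)

  isPrivate? : ∀ J → Decidable (IsPrivate J)
  isPrivate? J x = ¬? (x ∈? C) ×-dec all? (λ y → (x ~? y) →-dec (y ∈? J))

  P : Subset k → Subset k
  P J = comprehension (isPrivate? J)

  ∉C⇒∈PC : ∀ {x} → x ∉ C → x ∈ P C
  ∉C⇒∈PC x∉C = ∈-comprehension⁺ (isPrivate? C)
    (x∉C , λ y x~y → [ (λ x∈C → contradiction x∈C x∉C) , (λ y∈C → y∈C) ]′ (proj₁ minimum _ y x~y))

  -- Every edge at an element of `P J` has its other end in `J`. So the part of `S v` inside
  -- `J ∪ P J` can be traded for `J` without uncovering an edge, and minimality of `C` bounds the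
  -- size of the result from below. As `J ⊆ C`, the sets `J` and `P J` are disjoint and their parts
  -- in `S v` add up.
  exchange : ∀ {J} → J ⊆ C → ∀ v →
             ∣ C ∣ + (∣ S v ∩ J ∣ + ∣ S v ∩ P J ∣) ≤ ∣ J ∣ + Δ
  exchange {J} J⊆C v = begin
    ∣ C ∣ + (∣ S v ∩ J ∣ + ∣ S v ∩ P J ∣)
      ≤⟨ +-mono-≤ (≤-trans (proj₂ minimum (J ∪ R) exchanged) (∣p∪q∣≤∣p∣+∣q∣ J R)) two-parts ⟩
    ∣ J ∣ + ∣ R ∣ + ∣ S v ∩ (J ∪ P J) ∣
      ≡⟨ trans (+-assoc (∣ J ∣) _ _) (cong (∣ J ∣ +_) (+-comm (∣ R ∣) _)) ⟩
    ∣ J ∣ + (∣ S v ∩ (J ∪ P J) ∣ + ∣ R ∣)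
      ≡⟨ cong (∣ J ∣ +_) (∣p∣≡∣p∩q∣+∣p∩∁q∣ (S v) (J ∪ P J)) ⟨
    ∣ J ∣ + ∣ S v ∣
      ≤⟨ +-monoʳ-≤ (∣ J ∣) (∣S∣≤Δ v) ⟩
    ∣ J ∣ + Δ ∎
    where
    open ≤-Reasoning
    R : Subset k
    R = S v ∩ ∁ (J ∪ P J)

    replace : ∀ {a b} → a ~ b → a ∈ S v → a ∈ J ∪ R ⊎ b ∈ J ∪ R
    replace {a} {b} a~b a∈S with a ∈? J | a ∈? P J
    ... | yes a∈J | _        = inj₁ (x∈p∪q⁺ (inj₁ a∈J))
    ... | no  _   | yes a∈PJ =
      inj₂ (x∈p∪q⁺ (inj₁ (proj₂ (∈-comprehension⁻ (isPrivate? J) a∈PJ) b a~b)))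
    ... | no a∉J  | no a∉PJ  = inj₁ (x∈p∪q⁺ (inj₂ (x∈p∩q⁺
      (a∈S , x∉p⇒x∈∁p (λ a∈ → [ a∉J , a∉PJ ]′ (x∈p∪q⁻ J (P J) a∈))))))

    exchanged : IsCover H (J ∪ R)
    exchanged a b a~b with covers v a b a~b
    ... | inj₁ a∈S = replace a~b a∈S
    ... | inj₂ b∈S = swap (replace (~-sym a~b) b∈S)

    two-parts : ∣ S v ∩ J ∣ + ∣ S v ∩ P J ∣ ≤ ∣ S v ∩ (J ∪ P J) ∣
    two-parts = disjoint⇒∣p∣+∣q∣≤∣r∣ (S v ∩ J) (S v ∩ P J) _ (widen inj₁) (widen inj₂)
      λ x∈SJ x∈SP → proj₁ (∈-comprehension⁻ (isPrivate? J) (p∩q⊆q (S v) (P J) x∈SP))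
                          (J⊆C (p∩q⊆q (S v) J x∈SJ))
      where
      widen : ∀ {q} → (∀ {x} → x ∈ q → x ∈ J ⊎ x ∈ P J) → S v ∩ q ⊆ S v ∩ (J ∪ P J)
      widen {q} f x∈ with x∈S , x∈q ← x∈p∩q⁻ (S v) q x∈ = x∈p∩q⁺ (x∈S , x∈p∪q⁺ (f x∈q))

  -- If `x` in `P J` lies outside the cover `S v`, all its neighbours lie in `S v`, hence in
  -- `S v ∩ J`.
  peel : ∀ J v → ∣ P J ∣ ≤ ∣ S v ∩ P J ∣ + ∣ P (S v ∩ J) ∣
  peel J v = begin
    ∣ P J ∣                                ≡⟨ ∣p∣≡∣p∩q∣+∣p∩∁q∣ (P J) (S v) ⟩
    ∣ P J ∩ S v ∣ + ∣ P J ∩ ∁ (S v) ∣      ≤⟨ +-mono-≤ (p⊆q⇒∣p∣≤∣q∣ flip-∩) (p⊆q⇒∣p∣≤∣q∣ shrink) ⟩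
    ∣ S v ∩ P J ∣ + ∣ P (S v ∩ J) ∣        ∎
    where
    open ≤-Reasoning
    flip-∩ : P J ∩ S v ⊆ S v ∩ P J
    flip-∩ x∈ with x∈P , x∈S ← x∈p∩q⁻ (P J) (S v) x∈ = x∈p∩q⁺ (x∈S , x∈P)

    shrink : P J ∩ ∁ (S v) ⊆ P (S v ∩ J)
    shrink {x} x∈ with x∈P , x∈∁S ← x∈p∩q⁻ (P J) (∁ (S v)) x∈
      with x∉C , N⊆J ← ∈-comprehension⁻ (isPrivate? J) x∈P
      = ∈-comprehension⁺ (isPrivate? (S v ∩ J)) (x∉C , λ y x~y → x∈p∩q⁺
          ( [ (λ x∈S → contradiction x∈S (x∈∁p⇒x∉p x∈∁S)) , (λ y∈S → y∈S) ]′ (covers v x y x~y)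
          , N⊆J y x~y))

  S∩J⊂J : ∀ {J v a} → a ∈ J → a ∉ S v → S v ∩ J ⊂ J
  S∩J⊂J {J} {v} a∈J a∉S = p∩q⊆q (S v) J , _ , a∈J , a∉S ∘ p∩q⊆p (S v) J

  module _ {r : ℕ} (∣C∣+r≡Δ : ∣ C ∣ + r ≡ Δ) where

    -- One descent from `J` to `S v ∩ J`: `peel` splits `P J`, and `exchange` bounds the part inside
    -- `S v`.
    step : ∀ {J} → J ⊆ C → ∀ v → ∣ S v ∩ J ∣ + ∣ P J ∣ ≤ ∣ J ∣ + r + ∣ P (S v ∩ J) ∣
    step {J} J⊆C v = +-cancelˡ-≤ (∣ C ∣) _ _ (begin
      ∣ C ∣ + (∣ S v ∩ J ∣ + ∣ P J ∣)
        ≤⟨ +-monoʳ-≤ (∣ C ∣) (+-monoʳ-≤ (∣ S v ∩ J ∣) (peel J v)) ⟩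
      ∣ C ∣ + (∣ S v ∩ J ∣ + (∣ S v ∩ P J ∣ + ∣ P (S v ∩ J) ∣))
        ≡⟨ regroup (∣ C ∣) (∣ S v ∩ J ∣) (∣ S v ∩ P J ∣) _ ⟩
      ∣ C ∣ + (∣ S v ∩ J ∣ + ∣ S v ∩ P J ∣) + ∣ P (S v ∩ J) ∣
        ≤⟨ +-monoˡ-≤ _ (exchange J⊆C v) ⟩
      ∣ J ∣ + Δ + ∣ P (S v ∩ J) ∣
        ≡⟨ cong (λ z → ∣ J ∣ + z + ∣ P (S v ∩ J) ∣) ∣C∣+r≡Δ ⟨
      ∣ J ∣ + (∣ C ∣ + r) + ∣ P (S v ∩ J) ∣
        ≡⟨ commute (∣ J ∣) (∣ C ∣) r _ ⟩
      ∣ C ∣ + (∣ J ∣ + r + ∣ P (S v ∩ J) ∣) ∎)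
      where
      open ≤-Reasoning
      regroup : ∀ c j l p → c + (j + (l + p)) ≡ c + (j + l) + p
      regroup = solve-∀
      commute : ∀ j c r p → j + (c + r) + p ≡ c + (j + r + p)
      commute = solve-∀

    -- Induction on a bound for the size of `J`, descending along `step` to the intersection with
    -- some `S v` that misses an element of `J`.
    ∣PJ∣≤∣J∣[1+r] : ∀ {J} → J ⊆ C → ∣ P J ∣ ≤ ∣ J ∣ * suc r
    ∣PJ∣≤∣J∣[1+r] {J} J⊆C = go ∣ J ∣ J⊆C ≤-refl
      where
      open ≤-Reasoning
      go : ∀ b {J} → J ⊆ C → ∣ J ∣ ≤ b → ∣ P J ∣ ≤ ∣ J ∣ * suc r
      go b {J} J⊆C ∣J∣≤b with nonempty? J
      -- Every vertex has a neighbour, so `P J` is empty when `J` is; its inclusion in `J` is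
      -- vacuous.
      ... | no  empty = ≤-trans
        (p⊆q⇒∣p∣≤∣q∣ {q = J} λ {x} x∈P → contradiction
          (_ , proj₂ (∈-comprehension⁻ (isPrivate? J) x∈P) _ (proj₂ (partner x))) empty)
        (m≤m*n (∣ J ∣) (suc r))
      go zero J⊆C ∣J∣≤0 | yes (a , a∈J) with v , a∉S ← misses a =
        contradiction (≤-trans (p⊂q⇒∣p∣<∣q∣ (S∩J⊂J a∈J a∉S)) ∣J∣≤0) λ ()
      go (suc b) {J} J⊆C ∣J∣≤b | yes (a , a∈J) with v , a∉S ← misses a
        = +-cancelˡ-≤ (∣ S v ∩ J ∣) _ _ (begin
          ∣ S v ∩ J ∣ + ∣ P J ∣                 ≤⟨ step J⊆C v ⟩
          ∣ J ∣ + r + ∣ P (S v ∩ J) ∣           ≤⟨ +-monoʳ-≤ (∣ J ∣ + r)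
                                                     (go b (J⊆C ∘ p∩q⊆q (S v) J) (s≤s⁻¹ (≤-trans fewer ∣J∣≤b))) ⟩
          ∣ J ∣ + r + ∣ S v ∩ J ∣ * suc r       ≡⟨ regroup (∣ J ∣) (∣ S v ∩ J ∣) r ⟩
          ∣ S v ∩ J ∣ + (∣ J ∣ + suc (∣ S v ∩ J ∣) * r)
            -- The strict decrease pays for the extra `r` that this descent costs.
            ≤⟨ +-monoʳ-≤ (∣ S v ∩ J ∣) (+-monoʳ-≤ (∣ J ∣) (*-monoˡ-≤ r fewer)) ⟩
          ∣ S v ∩ J ∣ + (∣ J ∣ + ∣ J ∣ * r)     ≡⟨ cong (∣ S v ∩ J ∣ +_) (*-suc (∣ J ∣) r) ⟨
          ∣ S v ∩ J ∣ + ∣ J ∣ * suc r           ∎)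
        where
        fewer : ∣ S v ∩ J ∣ < ∣ J ∣
        fewer = p⊂q⇒∣p∣<∣q∣ (S∩J⊂J a∈J a∉S)
        regroup : ∀ j i r → j + r + i * suc r ≡ i + (j + suc i * r)
        regroup = solve-∀

  k≤∣C∣+∣PC∣ : k ≤ ∣ C ∣ + ∣ P C ∣
  k≤∣C∣+∣PC∣ = begin
    k                  ≡⟨ m+[n∸m]≡n (∣p∣≤n C) ⟨
    ∣ C ∣ + (k ∸ ∣ C ∣)  ≡⟨ cong (∣ C ∣ +_) (∣∁p∣≡n∸∣p∣ C) ⟨
    ∣ C ∣ + ∣ ∁ C ∣    ≤⟨ +-monoʳ-≤ (∣ C ∣) (p⊆q⇒∣p∣≤∣q∣ (∉C⇒∈PC ∘ x∈∁p⇒x∉p)) ⟩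
    ∣ C ∣ + ∣ P C ∣    ∎
    where open ≤-Reasoning

-- The case of equality

module Extremal {t : ℕ} (2≤t : 2 ≤ t) (k≡ : k ≡ suc t * suc t)
                {H : Graph k} (F : CoverFamily H n (t + t))
                {C : Subset k} (minimum : IsMinimumCover H C) where
  open Graph H
  open CoverFamily F
  open PrivateNeighbours F minimum

  slack : ∃[ r ] ∣ C ∣ + r ≡ t + t
  slack = m≤n⇒∃[o]m+o≡n (≤-trans (proj₂ minimum (S v₀) (covers v₀)) (∣S∣≤Δ v₀))
    where
    -- As `k` is positive there is a class, and with it a vertex that it misses; this supplies one
    -- cover `S v₀` of size at most `t + t`.
    v₀ = proj₁ (misses (subst Fin (sym k≡) Fin.zero))

  r = proj₁ slack

  abstract
    -- The factors `∣ C ∣` and `2 + r` have sum `2 (t + 1)`, while their product is at least `k`,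
    -- the square of `t + 1`; so both equal their mean.
    ∣C∣≡1+t : ∣ C ∣ ≡ suc t
    ∣C∣≡1+t = square≤product⇒equal (∣ C ∣) (2 + r) (suc t) total (begin
      suc t * suc t           ≡⟨ k≡ ⟨
      k                       ≤⟨ k≤∣C∣+∣PC∣ ⟩
      ∣ C ∣ + ∣ P C ∣         ≤⟨ +-monoʳ-≤ (∣ C ∣) (∣PJ∣≤∣J∣[1+r] (proj₂ slack) (λ x∈C → x∈C)) ⟩
      ∣ C ∣ + ∣ C ∣ * suc r   ≡⟨ *-suc (∣ C ∣) (suc r) ⟨
      ∣ C ∣ * (2 + r)         ∎)
      where
      open ≤-Reasoning
      regroup : ∀ c r → c + (2 + r) ≡ 2 + (c + r)
      regroup = solve-∀
      total : ∣ C ∣ + (2 + r) ≡ suc t + suc t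
      total = trans (regroup (∣ C ∣) r) (trans (cong (2 +_) (proj₂ slack)) (cong suc (sym (+-suc t t))))

  1+r≡t : suc r ≡ t
  1+r≡t = +-cancelˡ-≡ t (suc r) t
    (trans (+-suc t r) (trans (cong (_+ r) (sym ∣C∣≡1+t)) (proj₂ slack)))

  [1+t]t≤∣PC∣ : suc t * t ≤ ∣ P C ∣
  [1+t]t≤∣PC∣ = +-cancelˡ-≤ (suc t) _ _ (begin
    suc t + suc t * t    ≡⟨ *-suc (suc t) t ⟨
    suc t * suc t        ≡⟨ k≡ ⟨
    k                    ≤⟨ k≤∣C∣+∣PC∣ ⟩
    ∣ C ∣ + ∣ P C ∣      ≡⟨ cong (_+ ∣ P C ∣) ∣C∣≡1+t ⟩
    suc t + ∣ P C ∣      ∎)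
    where open ≤-Reasoning

  ∣P[S∩C]∣≤∣S∩C∣t : ∀ v → ∣ P (S v ∩ C) ∣ ≤ ∣ S v ∩ C ∣ * t
  ∣P[S∩C]∣≤∣S∩C∣t v = subst (λ z → ∣ P (S v ∩ C) ∣ ≤ ∣ S v ∩ C ∣ * z) 1+r≡t
    (∣PJ∣≤∣J∣[1+r] (proj₂ slack) (p∩q⊆q (S v) C))

  module _ {a} (a∈C : a ∈ C) {v} (a∉S : a ∉ S v) where

    -- Write `j` for the left side; `j ≤ t` because `a` is missed. Playing the lower bound for
    -- `∣ P C ∣` against `step` leaves `j + t * t ≤ t + j * t`, which forces `j = t` because
    -- `2 ≤ t`.
    ∣S∩C∣≡t : ∣ S v ∩ C ∣ ≡ t
    ∣S∩C∣≡t = j+tt≤t+jt⇒j≡t 2≤t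
      (s≤s⁻¹ (subst (∣ S v ∩ C ∣ <_) ∣C∣≡1+t (p⊂q⇒∣p∣<∣q∣ (S∩J⊂J {C} a∈C a∉S))))
      (+-cancelˡ-≤ t _ _ (begin
        t + (∣ S v ∩ C ∣ + t * t)           ≡⟨ regroup t (∣ S v ∩ C ∣) ⟩
        ∣ S v ∩ C ∣ + suc t * t             ≤⟨ +-monoʳ-≤ (∣ S v ∩ C ∣) [1+t]t≤∣PC∣ ⟩
        ∣ S v ∩ C ∣ + ∣ P C ∣               ≤⟨ step (proj₂ slack) (λ x∈C → x∈C) v ⟩
        ∣ C ∣ + r + ∣ P (S v ∩ C) ∣         ≡⟨ cong (_+ ∣ P (S v ∩ C) ∣) (proj₂ slack) ⟩
        t + t + ∣ P (S v ∩ C) ∣             ≤⟨ +-monoʳ-≤ (t + t) (∣P[S∩C]∣≤∣S∩C∣t v) ⟩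
        t + t + ∣ S v ∩ C ∣ * t             ≡⟨ +-assoc t t _ ⟩
        t + (t + ∣ S v ∩ C ∣ * t)           ∎))
      where
      open ≤-Reasoning
      regroup : ∀ t j → t + (j + t * t) ≡ j + suc t * t
      regroup = solve-∀

    abstract
      -- `S v` has room for at most `t` elements besides its `t` elements of `C`. Conversely, at
      -- most `t * t` of the at least `(t + 1) t` elements of `P C` can avoid `S v`, by `peel`.
      ∣S∩PC∣≡t : ∣ S v ∩ P C ∣ ≡ t
      ∣S∩PC∣≡t = ≤-antisym
        (+-cancelˡ-≤ t _ _ (begin
          t + ∣ S v ∩ P C ∣             ≡⟨ cong (_+ ∣ S v ∩ P C ∣) ∣S∩C∣≡t ⟨
          ∣ S v ∩ C ∣ + ∣ S v ∩ P C ∣   ≤⟨ +-cancelˡ-≤ (∣ C ∣) _ _ (exchange (λ x∈C → x∈C) v) ⟩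
          t + t                         ∎))
        (+-cancelʳ-≤ (t * t) _ _ (begin
          suc t * t                              ≤⟨ [1+t]t≤∣PC∣ ⟩
          ∣ P C ∣                                ≤⟨ peel C v ⟩
          ∣ S v ∩ P C ∣ + ∣ P (S v ∩ C) ∣        ≤⟨ +-monoʳ-≤ (∣ S v ∩ P C ∣) (∣P[S∩C]∣≤∣S∩C∣t v) ⟩
          ∣ S v ∩ P C ∣ + ∣ S v ∩ C ∣ * t        ≡⟨ cong (λ z → ∣ S v ∩ P C ∣ + z * t) ∣S∩C∣≡t ⟩
          ∣ S v ∩ P C ∣ + t * t                  ∎))
        where open ≤-Reasoning

    -- Missing a second element of `C` would leave at most `t - 1` of the `t + 1` elements in `S v`.
    C-a⊆S : ∀ {b} → b ∈ C → a ≢ b → b ∈ S v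
    C-a⊆S {b} b∈C a≢b with b ∈? S v
    ... | yes b∈S = b∈S
    ... | no  b∉S = contradiction
      (≤-trans (s≤s (p⊂q⇒∣p∣<∣q∣ S∩C⊂C-a)) (x∈p⇒∣p-x∣<∣p∣ a∈C))
      (subst₂ (λ i j → ¬ (2 + i ≤ j)) (sym ∣S∩C∣≡t) (sym ∣C∣≡1+t) 1+n≰n)
      where
      S∩C⊂C-a : S v ∩ C ⊂ C - a
      S∩C⊂C-a = (λ x∈ → x∈p∧x≢y⇒x∈p-y (p∩q⊆q (S v) C x∈) λ { refl → a∉S (p∩q⊆p (S v) C x∈) })
              , b , x∈p∧x≢y⇒x∈p-y b∈C (a≢b ∘ sym) , b∉S ∘ p∩q⊆p (S v) C

  -- No `S v` misses both `a` and `b`, and that is the criterion for an edge.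
  clique-edge : ∀ {a b} → a ∈ C → b ∈ C → a ≢ b → a ~ b
  clique-edge {a} a∈C b∈C a≢b = edge a≢b λ v → one-of-two v (a ∈? S v)
    where
    one-of-two : ∀ v → Dec (a ∈ S v) → a ∈ S v ⊎ _ ∈ S v
    one-of-two v (yes a∈S) = inj₁ a∈S
    one-of-two v (no  a∉S) = inj₂ (C-a⊆S a∈C a∉S b∈C a≢b)

  centre : Fin (suc t) → Fin k
  centre = enumerate C ∣C∣≡1+t

  centre∈C : ∀ a → centre a ∈ C
  centre∈C = enumerate-∈ C ∣C∣≡1+t

  -- Built from one arbitrarily chosen `S v` that misses the centre. By construction it contains all
  -- neighbours of the centre outside `C`; that it contains nothing else is known only from
  -- `leaf-edge`.
  leaves : Fin (suc t) → Subset k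
  leaves a = S (proj₁ (misses (centre a))) ∩ P C

  ∣leaves∣≡t : ∀ a → ∣ leaves a ∣ ≡ t
  ∣leaves∣≡t a = ∣S∩PC∣≡t (centre∈C a) (proj₂ (misses (centre a)))

  label : Fin (suc t) × Fin (suc t) → Fin k
  label (a , Fin.zero)  = centre a
  label (a , Fin.suc i) = enumerate (leaves a) (∣leaves∣≡t a) i

  -- The end `y` lies in the cover `C`, so it is some centre. The set `S v` chosen for that centre
  -- misses `y`, and being a cover it contains `x`.
  outside-nbr : ∀ {x y} → x ∉ C → x ~ y →
                ∃[ a ] ∃[ i ] (label (a , Fin.zero) ≡ y × label (a , Fin.suc i) ≡ x)
  outside-nbr {x} {y} x∉C x~y with proj₁ minimum x y x~y
  ... | inj₁ x∈C = contradiction x∈C x∉C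
  ... | inj₂ y∈C with a , refl ← enumerate-hits C ∣C∣≡1+t y∈C
    with covers (proj₁ (misses (centre a))) x y x~y
  ... | inj₂ y∈S = contradiction y∈S (proj₂ (misses (centre a)))
  ... | inj₁ x∈S = a , proj₁ hit , refl , proj₂ hit
    where
    hit : ∃[ i ] label (a , Fin.suc i) ≡ x
    hit = enumerate-hits (leaves a) (∣leaves∣≡t a) (x∈p∩q⁺ (x∈S , ∉C⇒∈PC x∉C))

  label-hits : ∀ x → ∃[ p ] label p ≡ x
  label-hits x with x ∈? C
  ... | yes x∈C with a , eq ← enumerate-hits C ∣C∣≡1+t x∈C = (a , Fin.zero) , eq
  ... | no  x∉C with a , i , _ , eq ← outside-nbr x∉C (proj₂ (partner x)) = (a , Fin.suc i) , eq

  -- There are `(t + 1) * (t + 1) = k` labels and they reach all `k` vertices, so none is reached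
  -- twice. In particular the sets `leaves a` are pairwise disjoint. The pairs are coded by
  -- `remQuot` and `combine` to compare two finite ordinals.
  label-injective : Injective _≡_ _≡_ label
  label-injective {p} {q} eq = begin
    p                                    ≡⟨ remQuot∘combine p ⟨
    remQuot (suc t) (uncurry combine p)  ≡⟨ cong (remQuot (suc t)) (label∘remQuot-injective (uncurry combine p) (uncurry combine q)
      (trans (cong label (remQuot∘combine p)) (trans eq (cong label (sym (remQuot∘combine q)))))) ⟩
    remQuot (suc t) (uncurry combine q)  ≡⟨ remQuot∘combine q ⟩
    q                                    ∎
    where
    open ≡-Reasoning
    remQuot∘combine : ∀ p → remQuot {suc t} (suc t) (uncurry combine p) ≡ p
    remQuot∘combine (i , j) = remQuot-combine i j

    label∘remQuot-injective : ∀ x y → label (remQuot (suc t) x) ≡ label (remQuot (suc t) y) → x ≡ y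
    label∘remQuot-injective _ _ = hits⇒injective {f = label ∘ remQuot (suc t)} (sym k≡) λ x →
      let p , eq = label-hits x in uncurry combine p , trans (cong label (remQuot∘combine p)) eq

  leaf∉C : ∀ a i → label (a , Fin.suc i) ∉ C
  leaf∉C a i ∈C with b , eq ← enumerate-hits C ∣C∣≡1+t ∈C
    with () ← label-injective {b , Fin.zero} {a , Fin.suc i} eq

  -- By `outside-nbr` a neighbour `y` is a centre having this vertex among its leaves; by
  -- injectivity of `label` only one centre does.
  leaf-nbr : ∀ {a i y} → label (a , Fin.suc i) ~ y → label (a , Fin.zero) ≡ y
  leaf-nbr {a} {i} leaf~y with b , j , refl , eq ← outside-nbr (leaf∉C a i) leaf~y
    with refl ← label-injective {b , Fin.suc j} {a , Fin.suc i} eq = refl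

  -- The leaf has some neighbour, and `leaf-nbr` leaves only its centre.
  leaf-edge : ∀ {a i} → label (a , Fin.suc i) ~ label (a , Fin.zero)
  leaf-edge {a} {i} with y , leaf~y ← partner (label (a , Fin.suc i))
    with refl ← leaf-nbr {a} {i} leaf~y = leaf~y

  corona⇒~ : ∀ {p q} → Corona p q → label p ~ label q
  corona⇒~ (clique a≢b) = clique-edge (centre∈C _) (centre∈C _) (a≢b ∘ enumerate-injective C ∣C∣≡1+t)
  corona⇒~ (leafʳ {a} {j}) = ~-sym (leaf-edge {a} {j})
  corona⇒~ (leafˡ {a} {i}) = leaf-edge {a} {i}

  ~⇒corona : ∀ p q → label p ~ label q → Corona p q
  ~⇒corona (a , Fin.zero)  (b , Fin.zero)  a~b = clique λ { refl → ~-irrefl refl a~b }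
  ~⇒corona p@(a , Fin.suc i) q p~q
    with refl ← label-injective {a , Fin.zero} {q} (leaf-nbr {a} {i} p~q) = leafˡ
  ~⇒corona p@(a , Fin.zero) (b , Fin.suc j) p~q
    with refl ← label-injective {b , Fin.zero} {p} (leaf-nbr {b} {j} (~-sym p~q)) = leafʳ

-- Uniqueness of the extremal graph

record CoronaLabelling (m n : ℕ) (H : Graph k) : Set where
  open Graph H
  field
    labelling : (Fin m × Fin (suc n)) ↔ Fin k
    corona⇔~  : ∀ p q → Corona p q ⇔ (Inverse.to labelling p ~ Inverse.to labelling q)

extremal⇒corona : ∀ {t} {H : Graph k} → 2 ≤ t → k ≡ suc t * suc t →
                  CoverFamily H n (t + t) → CoronaLabelling (suc t) t H
extremal⇒corona {k} {H = H} 2≤t k≡ F = record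
  { labelling = mk↔ₛ′ label (proj₁ ∘ label-hits) (proj₂ ∘ label-hits)
                      (λ p → label-injective (proj₂ (label-hits (label p))))
  ; corona⇔~  = λ p q → mk⇔ corona⇒~ (~⇒corona p q)
  }
  where
  open CoverFamily F
  v₀ = proj₁ (misses (subst Fin (sym k≡) Fin.zero))
  open Extremal 2≤t k≡ F (proj₂ (minimumCover H (covers v₀)))

corona-unique : {G H : Graph k} → CoronaLabelling m n G → CoronaLabelling m n H → G ≅ H
corona-unique {k} {G = G} {H} L M =
  Composition.inverse (Symmetry.inverse L.labelling) M.labelling , λ u v → mk⇔
    (λ u~v → Equivalence.to (M.corona⇔~ _ _) (Equivalence.from (L.corona⇔~ _ _)
      (subst₂ G._~_ (sym (to∘from u)) (sym (to∘from v)) u~v)))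
    (λ fu~fv → subst₂ G._~_ (to∘from u) (to∘from v)
      (Equivalence.to (L.corona⇔~ _ _) (Equivalence.from (M.corona⇔~ _ _) fu~fv)))
  where
  module G = Graph G
  module L = CoronaLabelling L
  module M = CoronaLabelling M
  to∘from : ∀ u → Inverse.to L.labelling (Inverse.from L.labelling u) ≡ u
  to∘from = Inverse.strictlyInverseˡ L.labelling

-- Total coalitions

module _ (G : Graph n) (Ψ : TotalCoalitionPartition G k) where
  open Graph G
  open TotalCoalitionPartition Ψ

  Meets : Fin n → Pred (Fin k) 0ℓ
  Meets v i = ∃[ u ] (u ∈ class i × v ~ u)

  meets? : ∀ v → Decidable (Meets v)
  meets? v i = any? λ u → (u ∈? class i) ×-dec (v ~? u)

  meeting : Fin n → Subset k
  meeting v = comprehension (meets? v)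

  -- Sending each vertex to its class maps the neighbourhood of `v` onto `meeting v`, so the degree
  -- of `v` is an upper bound.
  ∣meeting∣≤maxDegree : ∀ v → ∣ meeting v ∣ ≤ maxDegree G
  ∣meeting∣≤maxDegree v = ≤-trans
    (image⇒∣p∣≤∣q∣ (proj₁ ∘ covering) (meeting v) (neighbourhood G v) λ {i} i∈ →
      let u , u∈i , v~u = ∈-comprehension⁻ (meets? v) i∈
      in u , ∈-comprehension⁺ (v ~?_) v~u , class-unique u∈i)
    (x∈xs⇒x≤foldr⊔ (∈-map⁺ (degree G) (∈-allFin v)))
    where
    class-unique : ∀ {u i} → u ∈ class i → proj₁ (covering u) ≡ i
    class-unique {u} {i} u∈i with covering u
    ... | j , u∈j with j ≟ i
    ...   | yes j≡i = j≡i
    ...   | no  j≢i = contradiction (u , x∈p∩q⁺ (u∈j , u∈i)) (disjoint j i j≢i)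

  not-dominating : ∀ i → ¬ TotalDominating G (class i)
  not-dominating i = let _ , _ , _ , ¬i , _ = partner i in ¬i

  coalitionFamily : CoverFamily (TCG G Ψ) n (maxDegree G)
  coalitionFamily = record
    { S       = meeting
    ; covers  = λ { v i j (_ , _ , _ , ij) → met v i j (ij v) }
    ; edge    = λ {i} {j} i≢j meets →
        disjoint i j i≢j , not-dominating i , not-dominating j , λ v → dominated v i j (meets v)
    ; misses  = λ i →
        -- Decidability of `meets?` turns the failure of domination into an actual undominated
        -- vertex.
        let v , ¬meets = ¬∀⟶∃¬ n _ (λ v → meets? v i) (not-dominating i)
        in v , ¬meets ∘ ∈-comprehension⁻ (meets? v)
    ; partner = λ i → let j , _ , ij = partner i in j , ij
    ; ∣S∣≤Δ   = ∣meeting∣≤maxDegree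
    }
    where
    met : ∀ v i j → ∃[ u ] (u ∈ class i ∪ class j × v ~ u) → i ∈ meeting v ⊎ j ∈ meeting v
    met v i j (u , u∈ , v~u) with x∈p∪q⁻ (class i) (class j) u∈
    ... | inj₁ u∈i = inj₁ (∈-comprehension⁺ (meets? v) (u , u∈i , v~u))
    ... | inj₂ u∈j = inj₂ (∈-comprehension⁺ (meets? v) (u , u∈j , v~u))

    dominated : ∀ v i j → i ∈ meeting v ⊎ j ∈ meeting v → ∃[ u ] (u ∈ class i ∪ class j × v ~ u)
    dominated v i j (inj₁ i∈) with u , u∈i , v~u ← ∈-comprehension⁻ (meets? v) i∈
      = u , x∈p∪q⁺ (inj₁ u∈i) , v~u
    dominated v i j (inj₂ j∈) with u , u∈j , v~u ← ∈-comprehension⁻ (meets? v) j∈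
      = u , x∈p∪q⁺ (inj₂ u∈j) , v~u

-- For even maximum degree the prescribed number of classes is a perfect square, the form in which
-- the case of equality is analysed.
[2t]²/4+2t+1≡[1+t]² : ∀ t → (t * 2) ^ 2 / 4 + t * 2 + 1 ≡ suc t * suc t
[2t]²/4+2t+1≡[1+t]² t = trans
  (cong (λ z → z + t * 2 + 1) (trans (cong (_/ 4) (square t)) (m*n/n≡m (t * t) 4)))
  (expand t)
  where
  square : ∀ t → t * 2 * (t * 2 * 1) ≡ t * t * 4
  square = solve-∀
  expand : ∀ t → t * t + t * 2 + 1 ≡ suc t * suc t
  expand = solve-∀

theorem5p1 : ∀ {n : ℕ} (G : Graph n) → IsolateFree G →
    2 ∣ maxDegree G → maxDegree G ≥ 6 →
    ∀ (tc : ℕ) → IsTotalCoalitionNumber G tc →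
    tc ≡ maxDegree G ^ 2 / 4 + maxDegree G + 1 →
    ∀ (Ψ Ψ′ : TotalCoalitionPartition G tc) →
    TCG G Ψ ≅ TCG G Ψ′
theorem5p1 G _ (divides t Δ≡t*2) Δ≥6 tc _ tc≡ Ψ Ψ′ =
  -- Both coalition graphs are the corona of the complete graph on `t + 1` vertices with `t` leaves
  -- at each, and `t` depends on `G` alone.
  corona-unique (corona Ψ) (corona Ψ′)
  where
  2≤t : 2 ≤ t
  2≤t = ≤-trans (n≤1+n 2) (*-cancelʳ-≤ 3 t 2 (subst (6 ≤_) Δ≡t*2 Δ≥6))

  corona : ∀ Ψ → CoronaLabelling (suc t) t (TCG G Ψ)
  corona Ψ = extremal⇒corona 2≤t
    (trans tc≡ (trans (cong (λ d → d ^ 2 / 4 + d + 1) Δ≡t*2) ([2t]²/4+2t+1≡[1+t]² t)))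
    (subst (CoverFamily (TCG G Ψ) _) (trans Δ≡t*2 (trans (*-comm t 2) (cong (t +_) (+-identityʳ t))))
      (coalitionFamily G Ψ))
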